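{- Let $T$ be a tree of order at least $6$. Then $T\in\mathcal{O}'$ if and only if the set of weak support vertices of $T$ is a maximum $2$-packing in $T$.
   Context: A weak support vertex is a vertex adjacent to exactly one leaf. A $2$-packing of a graph $G$ is a set $S\subseteq V(G)$ whose vertices are pairwise at distance at least $3$; a maximum $2$-packing is one of maximum cardinality $\rho(G)$. $2$-subdivision: let $G$ be a connected graph of order at least $2$ and $\mathcal{P}=\{\mathcal{P}(v):v\in V(G)\}$ where $\mathcal{P}(v)$ is a partition of $N_G(v)$ (into nonempty blocks). $G(\mathcal{P})$ has vertex set $V(G)\cup(V(G)\times\{1\})\cup\bigcup_{v\in V(G)}(\{v\}\times\mathcal{P}(v))$ and edge set $E_1\cup E_2\cup E_3$, where $E_1=\{v(v,1):v\in V(G)\}$, $E_2=\{v(v,A): v\in V(G), A\in\mathcal{P}(v)\}$, and $E_3=\{(u,A)(v,B): uv\in E(G), A\in\mathcal{P}(u), B\in\mathcal{P}(v), v\in A, u\in B\}$. $\mathcal{O}'$ is the family of all trees isomorphic to some $R(\mathcal{P})$ where $R$ is a tree of order at least $2$ and $\mathcal{P}$ is such a family of partitions. -}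

module Defs where

open import Data.Nat using (ℕ; suc; _≤_; _≟_)
open import Data.Fin as Fin using (Fin)
open import Data.Fin.Subset using (Subset; _∈_; _∩_; ∣_∣; Nonempty; Empty)
open import Data.Fin.Subset.Properties using (_∈?_)
open import Data.List.Base as List using (List)
open import Data.List.Relation.Unary.Unique.Propositional using (Unique)
open import Data.Product using (Σ; ∃; _×_; _,_)
open import Data.Vec.Base using (tabulate)
open import Function.Bundles using (_↔_; _⇔_; module Inverse)
open import Level using (Level; 0ℓ)
open import Relation.Binary.Construct.Closure.Symmetric
  using (SymClosure; fwd; bwd; symmetric)
open import Relation.Binary.Core using (Rel)
open import Relation.Binary.Definitions using (Symmetric; Irreflexive; Decidable)
open import Relation.Binary.PropositionalEquality using (_≡_; _≢_; refl)
open import Relation.Nullary using (¬_; no; does)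
open import Relation.Nullary.Decidable using (map′; _×-dec_; _⊎-dec_)
open import Relation.Unary as U using (Pred)
open import Data.Sum using (inj₁; inj₂)

-- Simple graphs.  Decidability of adjacency is automatic classically; here it
-- makes neighbourhoods and degrees computable.
record Graph (V : Set) : Set₁ where
  field
    Adj    : Rel V 0ℓ
    sym    : Symmetric Adj
    irrefl : Irreflexive _≡_ Adj
    adj?   : Decidable Adj

open Graph public using (Adj)

infix 4 _≅_

record _≅_ {V W : Set} (G : Graph V) (H : Graph W) : Set where
  field
    bijection : V ↔ W
    preserves : ∀ u v → Adj G u v ⇔
                        Adj H (Inverse.to bijection u) (Inverse.to bijection v)

module _ {V : Set} (G : Graph V) where

  data Walk : V → V → ℕ → Set where
    []  : ∀ {v} → Walk v v 0
    _∷_ : ∀ {u v w k} → Adj G u v → Walk v w k → Walk u w (suc k)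

  vertices : ∀ {u v k} → Walk u v k → List V
  vertices {u} []      = u List.∷ List.[]
  vertices {u} (_ ∷ p) = u List.∷ vertices p

  Connected : Set
  Connected = ∀ u v → ∃ λ k → Walk u v k

  -- A cycle is a path with at least three vertices whose ends are adjacent.
  Acyclic : Set
  Acyclic = ∀ {u v k} (p : Walk u v k) → 2 ≤ k → Unique (vertices p) →
            ¬ Adj G v u

  IsTree : Set
  IsTree = Connected × Acyclic

  -- Distance is a relation, as there is none between different components.
  Distance : V → V → ℕ → Set
  Distance u v d = Walk u v d × (∀ k → Walk u v k → d ≤ k)

comprehension : ∀ {n} {ℓ : Level} {P : Pred (Fin n) ℓ} → U.Decidable P → Subset n
comprehension P? = tabulate (λ i → does (P? i))

module _ {n : ℕ} (G : Graph (Fin n)) where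

  N : Fin n → Subset n
  N v = comprehension (Graph.adj? G v)

  degree : Fin n → ℕ
  degree v = ∣ N v ∣

  leaves : Subset n
  leaves = comprehension (λ v → degree v ≟ 1)

  weakSupports : Subset n
  weakSupports = comprehension (λ v → ∣ N v ∩ leaves ∣ ≟ 1)

  Is2Packing : Subset n → Set
  Is2Packing S = ∀ {u v} → u ∈ S → v ∈ S → u ≢ v →
                 ∀ d → Distance G u v d → 3 ≤ d

  IsMaximum2Packing : Subset n → Set
  IsMaximum2Packing S =
    Is2Packing S × (∀ S′ → Is2Packing S′ → ∣ S′ ∣ ≤ ∣ S ∣)

-- Blocks are listed by an index; nonempty and disjoint together make the
-- listing repetition-free, so the index set is in bijection with the partition.
record Partition {n : ℕ} (S : Subset n) : Set where
  field
    size     : ℕ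
    block    : Fin size → Subset n
    nonempty : ∀ i → Nonempty (block i)
    disjoint : ∀ {i j} → i ≢ j → Empty (block i ∩ block j)
    covers   : ∀ x → x ∈ S ⇔ (∃ λ i → x ∈ block i)

open Partition public using (size; block)

module Subdivision {n : ℕ} (G : Graph (Fin n)) (P : ∀ v → Partition (N G v)) where

  -- orig v, pend v and part v A stand for v, (v , 1) and (v , A).
  data Vertex : Set where
    orig : Fin n → Vertex
    pend : Fin n → Vertex
    part : (v : Fin n) → Fin (size (P v)) → Vertex

  data Edge : Rel Vertex 0ℓ where
    E₁ : ∀ v → Edge (orig v) (pend v)
    E₂ : ∀ v A → Edge (orig v) (part v A)
    E₃ : ∀ {u v A B} → Adj G u v → v ∈ block (P u) A → u ∈ block (P v) B →
         Edge (part u A) (part v B)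

  edge-irrefl : ∀ {x} → ¬ Edge x x
  edge-irrefl (E₃ a _ _) = Graph.irrefl G refl a

  edge? : Decidable Edge
  edge? (orig u) (orig v) = no λ ()
  edge? (orig u) (pend v) = map′ (λ { refl → E₁ u }) (λ { (E₁ _) → refl }) (u Fin.≟ v)
  edge? (orig u) (part v B) =
    map′ (λ { refl → E₂ u B }) (λ { (E₂ _ _) → refl }) (u Fin.≟ v)
  edge? (pend u) y = no λ ()
  edge? (part u A) (orig v) = no λ ()
  edge? (part u A) (pend v) = no λ ()
  edge? (part u A) (part v B) =
    map′ (λ { (a , p , q) → E₃ a p q }) (λ { (E₃ a p q) → a , p , q })
         (Graph.adj? G u v ×-dec (v ∈? block (P u) A) ×-dec (u ∈? block (P v) B))

  graph : Graph Vertex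
  graph = record
    { Adj    = SymClosure Edge
    ; sym    = symmetric Edge
    ; irrefl = λ { refl (fwd e) → edge-irrefl e ; refl (bwd e) → edge-irrefl e }
    ; adj?   = λ x y → map′ (λ { (inj₁ e) → fwd e ; (inj₂ e) → bwd e })
                            (λ { (fwd e) → inj₁ e ; (bwd e) → inj₂ e })
                            (edge? x y ⊎-dec edge? y x)
    }

𝒪′ : ∀ {n} → Graph (Fin n) → Set₁
𝒪′ T = IsTree T ×
  Σ ℕ λ m → 2 ≤ m ×
  Σ (Graph (Fin m)) λ R → IsTree R ×
  Σ (∀ v → Partition (N R v)) λ P → T ≅ Subdivision.graph R P

{-# OPTIONS --safe #-}

-- A set is a 2-packing when closed neighbourhoods contain at most one of its
-- elements each.  In R(𝒫) the weak supports are the vertices of R, and their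
-- closed neighbourhoods cover everything, so no 2-packing is larger.
-- Conversely, replacing every weak support by its leaf again gives a 2-packing,
-- and this one could be extended by any vertex outside the closed neighbourhoods
-- of the weak supports.  So if the weak supports form a maximum 2-packing, then
-- their closed neighbourhoods partition T; contracting them yields R, and the
-- blocks at w are the sets of cells reached through the non-leaf neighbours of w.
-- Acyclicity is used and transported in the form "every edge is a bridge".
module Submission where

open import Defs
open import Data.Empty using (⊥-elim)
open import Data.Nat as ℕ using (ℕ; zero; suc; _≤_; _<_; z≤n; s≤s)
open import Data.Nat.Properties using (≤-antisym; ≤-trans; <⇒≱; 1+n≰n)
open import Data.Bool.Base using (true; false)
open import Data.Fin using (Fin; zero; suc; _≟_; fromℕ<)
open import Data.Fin.Properties using (any?; injective⇒≤; suc-injective)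
open import Data.Fin.Subset using (Subset; _∈_; _∩_; ∣_∣)
open import Data.Fin.Subset.Properties using (x∈p∩q⁺; x∈p∩q⁻)
open import Data.List.Base as List using ()
open import Data.List.Membership.Propositional using () renaming (_∈_ to _∈ₗ_; _∉_ to _∉ₗ_)
open import Data.List.Relation.Unary.All as All using ()
open import Data.List.Relation.Unary.All.Properties using (¬Any⇒All¬)
open import Data.List.Relation.Unary.AllPairs using ([]; _∷_)
open import Data.List.Relation.Unary.Any as Any using (here; there)
open import Data.List.Relation.Unary.Unique.Propositional using (Unique)
open import Data.Product using (∃; ∃-syntax; _×_; _,_; proj₁; proj₂)
open import Data.Sum using (_⊎_; inj₁; inj₂)
open import Data.Vec.Base using ([]; _∷_; here; there)
open import Data.Vec.Properties using (lookup∘tabulate; lookup⇒[]=; []=⇒lookup)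
open import Function.Base using (_∘_)
open import Function.Bundles using (_⇔_; mk⇔; mk↔ₛ′; module Inverse; module Equivalence)
open import Function.Definitions using (Injective)
open import Relation.Binary.Construct.Closure.ReflexiveTransitive
  using (Star; ε; _◅_; _◅◅_; kleisliStar)
open import Relation.Binary.Construct.Closure.Symmetric using (fwd; bwd)
open import Relation.Binary.PropositionalEquality
  using (_≡_; _≢_; refl; sym; trans; cong; subst; subst₂)
open import Relation.Nullary using (¬_; Dec; yes; no)
open import Relation.Nullary.Decidable using (_×-dec_; _⊎-dec_; ¬?; dec-true)
open import Relation.Unary as U using (Pred)

-- Finite subsets

∈-comprehension⁺ : ∀ {n ℓ} {P : Pred (Fin n) ℓ} (P? : U.Decidable P) {i} →
                   P i → i ∈ comprehension P?
∈-comprehension⁺ P? {i} p =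
  lookup⇒[]= i _ (trans (lookup∘tabulate _ i) (dec-true (P? i) p))

∈-comprehension⁻ : ∀ {n ℓ} {P : Pred (Fin n) ℓ} (P? : U.Decidable P) {i} →
                   i ∈ comprehension P? → P i
∈-comprehension⁻ P? {i} i∈ with P? i | trans (sym (lookup∘tabulate _ i)) ([]=⇒lookup i∈)
... | yes p | _ = p
... | no _  | ()

enum : ∀ {n} (S : Subset n) → Fin ∣ S ∣ → Fin n
enum (true  ∷ S) zero    = zero
enum (true  ∷ S) (suc i) = suc (enum S i)
enum (false ∷ S) i       = suc (enum S i)

enum-∈ : ∀ {n} (S : Subset n) i → enum S i ∈ S
enum-∈ (true  ∷ S) zero    = here
enum-∈ (true  ∷ S) (suc i) = there (enum-∈ S i)
enum-∈ (false ∷ S) i       = there (enum-∈ S i)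

enum-injective : ∀ {n} (S : Subset n) → Injective _≡_ _≡_ (enum S)
enum-injective (true  ∷ S) {zero}  {zero}  _  = refl
enum-injective (true  ∷ S) {suc i} {suc j} eq =
  cong suc (enum-injective S (suc-injective eq))
enum-injective (false ∷ S) eq = enum-injective S (suc-injective eq)

enum-surjective : ∀ {n} (S : Subset n) {x} → x ∈ S → ∃[ i ] enum S i ≡ x
enum-surjective (true  ∷ S) here = zero , refl
enum-surjective (true  ∷ S) (there x∈S) with enum-surjective S x∈S
... | i , refl = suc i , refl
enum-surjective (false ∷ S) (there x∈S) with enum-surjective S x∈S
... | i , refl = i , refl

-- Every lower bound on a cardinality below is obtained here: an injection into `S` factors through
-- `enum S`, giving an injection between index types.
injective⇒≤∣S∣ : ∀ {k n} (S : Subset n) (f : Fin k → Fin n) →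
                 (∀ i → f i ∈ S) → Injective _≡_ _≡_ f → k ≤ ∣ S ∣
injective⇒≤∣S∣ S f f∈S f-inj = injective⇒≤ {f = index} index-inj
  where
  index : _ → Fin ∣ S ∣
  index i = proj₁ (enum-surjective S (f∈S i))
  index-inj : Injective _≡_ _≡_ index
  index-inj {i} {j} eq = f-inj (trans (sym (proj₂ (enum-surjective S (f∈S i))))
    (trans (cong (enum S) eq) (proj₂ (enum-surjective S (f∈S j)))))

∣S∣≡1⇒singleton : ∀ {n} (S : Subset n) → ∣ S ∣ ≡ 1 →
                  ∃[ x ] x ∈ S × (∀ {y} → y ∈ S → y ≡ x)
∣S∣≡1⇒singleton S eq = enum S i₀ , enum-∈ S i₀ , λ y∈S →
  let i , eᵢ = enum-surjective S y∈S in trans (sym eᵢ) (cong (enum S) (all-equal eq i i₀))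
  where
  i₀ = subst Fin (sym eq) zero
  all-equal : ∀ {k} → k ≡ 1 → (i j : Fin k) → i ≡ j
  all-equal refl zero zero = refl

singleton⇒∣S∣≡1 : ∀ {n} (S : Subset n) {x} → x ∈ S → (∀ {y} → y ∈ S → y ≡ x) → ∣ S ∣ ≡ 1
singleton⇒∣S∣≡1 S {x} x∈S unique = ≤-antisym
  (injective⇒≤ {f = λ _ → zero {0}} λ {i} {j} _ →
    enum-injective S (trans (unique (enum-∈ S i)) (sym (unique (enum-∈ S j)))))
  (injective⇒≤∣S∣ S (λ (_ : Fin 1) → x) (λ _ → x∈S) λ { {zero} {zero} _ → refl })

-- Bridges

deleteEdge : ∀ {n} → Graph (Fin n) → Fin n → Fin n → Graph (Fin n)
deleteEdge G a b = record
  { Adj    = λ x y → Adj G x y × ¬ (x ≡ a × y ≡ b) × ¬ (x ≡ b × y ≡ a)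
  ; sym    = λ (e , p , q) → Graph.sym G e , (λ (r , s) → q (s , r)) , (λ (r , s) → p (s , r))
  ; irrefl = λ eq (e , _) → Graph.irrefl G eq e
  ; adj?   = λ x y → Graph.adj? G x y ×-dec ¬? ((x ≟ a) ×-dec (y ≟ b))
                                      ×-dec ¬? ((x ≟ b) ×-dec (y ≟ a))
  }

Connection : ∀ {V} → Graph V → V → V → Set
Connection G = Star (Adj G)

-- Unlike `Acyclic`, this form allows repeated vertices in a connection, so connections can be
-- concatenated, projected and lifted freely.
EveryEdgeBridge : ∀ {n} → Graph (Fin n) → Set
EveryEdgeBridge G = ∀ {a b} → Adj G a b → ¬ Connection (deleteEdge G a b) a b

≡⇒connection : ∀ {V} (G : Graph V) {u v} → u ≡ v → Connection G u v
≡⇒connection _ refl = ε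

walk⇒connection : ∀ {V} {G : Graph V} {u v k} → Walk G u v k → Connection G u v
walk⇒connection []      = ε
walk⇒connection (e ∷ p) = e ◅ walk⇒connection p

connection⇒walk : ∀ {V} {G : Graph V} {u v} → Connection G u v → ∃[ k ] Walk G u v k
connection⇒walk ε       = 0 , []
connection⇒walk (e ◅ p) = let k , q = connection⇒walk p in suc k , e ∷ q

end∈vertices : ∀ {V} {G : Graph V} {u v k} (p : Walk G u v k) → v ∈ₗ vertices G p
end∈vertices []      = here refl
end∈vertices (e ∷ p) = there (end∈vertices p)

start∈vertices : ∀ {V} {G : Graph V} {u v k} (p : Walk G u v k) → u ∈ₗ vertices G p
start∈vertices []      = here refl
start∈vertices (e ∷ p) = here refl

dropUntil : ∀ {V} {G : Graph V} {u v w k} (p : Walk G u v k) → Unique (vertices G p) →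
            w ∈ₗ vertices G p → ∃[ l ] ∃ λ (q : Walk G w v l) → Unique (vertices G q)
dropUntil []      uniq       (here refl) = 0 , [] , uniq
dropUntil (e ∷ p) uniq       (here refl) = _ , e ∷ p , uniq
dropUntil (e ∷ p) (_ ∷ uniq) (there w∈p) = dropUntil p uniq w∈p

-- Loop erasure: if the new start already lies on the path built from the tail, the path is cut down
-- to begin at that occurrence.
connection⇒path : ∀ {n} {G : Graph (Fin n)} {u v} → Connection G u v →
                  ∃[ k ] ∃ λ (p : Walk G u v k) → Unique (vertices G p)
connection⇒path ε = 0 , [] , All.[] ∷ []
connection⇒path {G = G} {u} (e ◅ c) with connection⇒path c
... | k , p , uniq with Any.any? (u ≟_) (vertices G p)
...   | yes u∈p = dropUntil p uniq u∈p
...   | no  u∉p = suc k , e ∷ p , ¬Any⇒All¬ _ u∉p ∷ uniq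

module _ {V : Set} {G H : Graph V} (f : ∀ {x y} → Adj H x y → Adj G x y) where

  mapWalk : ∀ {u v k} → Walk H u v k → Walk G u v k
  mapWalk []      = []
  mapWalk (e ∷ p) = f e ∷ mapWalk p

  vertices-mapWalk : ∀ {u v k} (p : Walk H u v k) → vertices G (mapWalk p) ≡ vertices H p
  vertices-mapWalk []      = refl
  vertices-mapWalk (e ∷ p) = cong (_ List.∷_) (vertices-mapWalk p)

-- Take a path from `a` to `b` that avoids the edge. Length 0 gives a loop, length 1 is the deleted
-- edge itself, and anything longer closes a cycle with `ab`.
acyclic⇒bridges : ∀ {n} {G : Graph (Fin n)} → Acyclic G → EveryEdgeBridge G
acyclic⇒bridges {G = G} acyclic {a} {b} ab c with connection⇒path c
... | 0 , [] , _ = Graph.irrefl G refl ab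
... | 1 , (_ , avoids , _) ∷ [] , _ = avoids (refl , refl)
... | suc (suc k) , p , uniq =
  acyclic (mapWalk {G = G} {H = deleteEdge G a b} proj₁ p) (s≤s (s≤s z≤n))
    (subst Unique (sym (vertices-mapWalk {G = G} {H = deleteEdge G a b} proj₁ p)) uniq)
    (Graph.sym G ab)

avoiding : ∀ {n} {G : Graph (Fin n)} {a b u v k} (p : Walk G u v k) →
           a ∉ₗ vertices G p → Connection (deleteEdge G a b) u v
avoiding []      _   = ε
avoiding (e ∷ p) a∉p =
  (e , (λ { (refl , _) → a∉p (here refl) })
     , (λ { (_ , refl) → a∉p (there (start∈vertices p)) }))
  ◅ avoiding p (a∉p ∘ there)

-- The closing edge of a cycle is bypassed by the rest of it. The first edge `e` differs from the
-- closing edge because its second vertex is not the last one; the remaining walk never returns to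
-- `u`, so it uses no edge at `u`.
bridges⇒acyclic : ∀ {n} {G : Graph (Fin n)} → EveryEdgeBridge G → Acyclic G
bridges⇒acyclic {G = G} bridges (e ∷ (f ∷ p)) _ (u∉ ∷ (x∉ ∷ _)) vu =
  bridges (Graph.sym G vu)
    ((e , (λ { (_ , refl) → All.lookup x∉ (end∈vertices p) refl })
        , (λ { (refl , _) → All.lookup u∉ (there (end∈vertices p)) refl }))
     ◅ avoiding (f ∷ p) λ u∈ → All.lookup u∉ u∈ refl)
bridges⇒acyclic _ (_ ∷ []) (s≤s ()) _ _

-- 2-packings

Near : ∀ {V} → Graph V → V → V → Set
Near G x y = x ≡ y ⊎ Adj G x y

near-sym : ∀ {V} (G : Graph V) {x y} → Near G x y → Near G y x
near-sym G (inj₁ refl) = inj₁ refl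
near-sym G (inj₂ e)    = inj₂ (Graph.sym G e)

near? : ∀ {n} (G : Graph (Fin n)) x y → Dec (Near G x y)
near? G x y = (x ≟ y) ⊎-dec Graph.adj? G x y

module _ {n : ℕ} (T : Graph (Fin n)) where

  -- Two members near a common vertex are at distance at most 2. As `Distance` demands a shortest
  -- walk, the adjacent case is settled first; non-adjacency then makes the walk through `x`
  -- minimal.
  packing⇒near-unique : ∀ {S} → Is2Packing T S → ∀ {x u v} → u ∈ S → v ∈ S →
                        Near T x u → Near T x v → u ≡ v
  packing⇒near-unique packing {x} {u} {v} u∈S v∈S xu xv with u ≟ v
  ... | yes u≡v = u≡v
  ... | no  u≢v with Graph.adj? T u v
  ...   | yes uv = ⊥-elim (too-close (packing u∈S v∈S u≢v 1 (uv ∷ [] , minimal)))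
    where
    too-close : ¬ (3 ≤ 1)
    too-close (s≤s ())
    minimal : ∀ k → Walk T u v k → 1 ≤ k
    minimal 0       []  = ⊥-elim (u≢v refl)
    minimal (suc k) _   = s≤s z≤n
  ...   | no ¬uv with xu | xv
  ...     | inj₁ refl | inj₁ refl = refl
  ...     | inj₁ refl | inj₂ xv′  = ⊥-elim (¬uv xv′)
  ...     | inj₂ xu′  | inj₁ refl = ⊥-elim (¬uv (Graph.sym T xu′))
  ...     | inj₂ xu′  | inj₂ xv′  =
    ⊥-elim (too-close (packing u∈S v∈S u≢v 2 (Graph.sym T xu′ ∷ (xv′ ∷ []) , minimal)))
    where
    too-close : ¬ (3 ≤ 2)
    too-close (s≤s (s≤s ()))
    minimal : ∀ k → Walk T u v k → 2 ≤ k
    minimal 0             []       = ⊥-elim (u≢v refl)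
    minimal 1             (e ∷ []) = ⊥-elim (¬uv e)
    minimal (suc (suc k)) _        = s≤s (s≤s z≤n)

  -- On a walk of length 1 the start is near both ends, on a walk of length 2 the midpoint is.
  near-unique⇒packing : ∀ {S} → (∀ {x u v} → u ∈ S → v ∈ S → Near T x u → Near T x v → u ≡ v) →
                        Is2Packing T S
  near-unique⇒packing unique u∈S v∈S u≢v _ (walk , _) with walk
  ... | []           = ⊥-elim (u≢v refl)
  ... | e ∷ []       = ⊥-elim (u≢v (unique u∈S v∈S (inj₁ refl) (inj₂ e)))
  ... | e ∷ (f ∷ []) = ⊥-elim (u≢v (unique u∈S v∈S (inj₂ (Graph.sym T e)) (inj₂ f)))
  ... | _ ∷ (_ ∷ (_ ∷ _)) = s≤s (s≤s (s≤s z≤n))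

  ∈N⁺ : ∀ {x y} → Adj T x y → y ∈ N T x
  ∈N⁺ {x} = ∈-comprehension⁺ (Graph.adj? T x)

  ∈N⁻ : ∀ {x y} → y ∈ N T x → Adj T x y
  ∈N⁻ {x} = ∈-comprehension⁻ (Graph.adj? T x)

  leaf⁺ : ∀ {x y} → Adj T x y → (∀ {z} → Adj T x z → z ≡ y) → x ∈ leaves T
  leaf⁺ {x} xy unique = ∈-comprehension⁺ (λ v → degree T v ℕ.≟ 1)
    (singleton⇒∣S∣≡1 (N T x) (∈N⁺ xy) (unique ∘ ∈N⁻))

  leaf⁻ : ∀ {x y z} → x ∈ leaves T → Adj T x y → Adj T x z → y ≡ z
  leaf⁻ {x} x∈ xy xz =
    let _ , _ , unique = ∣S∣≡1⇒singleton (N T x) (∈-comprehension⁻ (λ v → degree T v ℕ.≟ 1) x∈)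
    in trans (unique (∈N⁺ xy)) (sym (unique (∈N⁺ xz)))

  weakSupport⁺ : ∀ {x l} → Adj T x l → l ∈ leaves T →
                 (∀ {z} → Adj T x z → z ∈ leaves T → z ≡ l) → x ∈ weakSupports T
  weakSupport⁺ {x} xl l∈ unique = ∈-comprehension⁺ (λ v → ∣ N T v ∩ leaves T ∣ ℕ.≟ 1)
    (singleton⇒∣S∣≡1 (N T x ∩ leaves T) (x∈p∩q⁺ (∈N⁺ xl , l∈))
      λ z∈ → let z∈N , z∈leaves = x∈p∩q⁻ (N T x) (leaves T) z∈ in unique (∈N⁻ z∈N) z∈leaves)

  weakSupport⁻ : ∀ {x} → x ∈ weakSupports T →
                 ∃[ l ] Adj T x l × l ∈ leaves T ×
                        (∀ {z} → Adj T x z → z ∈ leaves T → z ≡ l)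
  weakSupport⁻ {x} x∈ =
    let l , l∈ , unique = ∣S∣≡1⇒singleton (N T x ∩ leaves T)
                            (∈-comprehension⁻ (λ v → ∣ N T v ∩ leaves T ∣ ℕ.≟ 1) x∈)
        l∈N , l∈leaves  = x∈p∩q⁻ (N T x) (leaves T) l∈
    in l , ∈N⁻ l∈N , l∈leaves , λ xz z∈ → unique (x∈p∩q⁺ (∈N⁺ xz , z∈))

-- Subdivisions

another : ∀ {m} → 2 ≤ m → (v : Fin m) → ∃[ u ] v ≢ u
another (s≤s (s≤s _)) zero    = suc zero , λ ()
another (s≤s (s≤s _)) (suc v) = zero , λ ()

hasNeighbour : ∀ {m} {R : Graph (Fin m)} → 2 ≤ m → Connected R → ∀ v → ∃[ u ] Adj R v u
hasNeighbour 2≤m connected v with another 2≤m v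
... | u , v≢u with connected v u
...   | 0     , []    = ⊥-elim (v≢u refl)
...   | suc _ , e ∷ _ = _ , e

module SubdivisionCells {m} (R : Graph (Fin m)) (P : ∀ v → Partition (N R v)) where

  open Subdivision R P

  cell : Vertex → Fin m
  cell (orig v)   = v
  cell (pend v)   = v
  cell (part v _) = v

  -- With `near-orig⇒cell≡` this shows that the closed neighbourhoods of the original vertices
  -- partition the subdivision, `cell` naming the class.
  near-cell : ∀ v → Near graph v (orig (cell v))
  near-cell (orig v)   = inj₁ refl
  near-cell (pend v)   = inj₂ (bwd (E₁ v))
  near-cell (part v A) = inj₂ (bwd (E₂ v A))

  near-orig⇒cell≡ : ∀ {v i} → Near graph v (orig i) → cell v ≡ i
  near-orig⇒cell≡ (inj₁ refl)           = refl
  near-orig⇒cell≡ (inj₂ (bwd (E₁ _)))   = refl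
  near-orig⇒cell≡ (inj₂ (bwd (E₂ _ _))) = refl

-- Weak supports of a subdivision

module FromSubdivision {n m} {T : Graph (Fin n)} {R : Graph (Fin m)}
  (2≤m : 2 ≤ m) (connected : Connected R) (P : ∀ v → Partition (N R v))
  (iso : T ≅ Subdivision.graph R P) where

  open Subdivision R P
  open SubdivisionCells R P
  open Inverse (_≅_.bijection iso)
    using (to; from; strictlyInverseˡ; strictlyInverseʳ)

  adj-to : ∀ {x y} → Adj T x y → Adj graph (to x) (to y)
  adj-to = Equivalence.to (_≅_.preserves iso _ _)

  adj-from : ∀ {v w} → Adj graph v w → Adj T (from v) (from w)
  adj-from e = Equivalence.from (_≅_.preserves iso _ _)
    (subst₂ (Adj graph) (sym (strictlyInverseˡ _)) (sym (strictlyInverseˡ _)) e)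

  to≡⇒≡from : ∀ {x v} → to x ≡ v → x ≡ from v
  to≡⇒≡from eq = trans (sym (strictlyInverseʳ _)) (cong from eq)

  blockAt : ∀ {u v} → Adj R u v → ∃[ A ] v ∈ block (P u) A
  blockAt {u} {v} uv =
    Equivalence.to (Partition.covers (P u) v) (∈N⁺ R uv)

  -- An obstruction to being a leaf, phrased by adjacency because `degree` is defined only for
  -- graphs on `Fin n`.
  Branching : Vertex → Set
  Branching x = ∃[ y ] ∃[ z ] Adj graph x y × Adj graph x z × y ≢ z

  -- A neighbour of `v` in `R` lies in some block, which supplies a second neighbour besides
  -- `pend v`.
  orig-branching : ∀ v → Branching (orig v)
  orig-branching v with hasNeighbour 2≤m connected v
  ... | u , vu = pend v , part v (proj₁ (blockAt vu)) , fwd (E₁ v) , fwd (E₂ v _) , λ ()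

  -- A block has an element `u`, and the block at `u` containing `v` gives a neighbour other than
  -- `orig v`.
  part-branching : ∀ v A → Branching (part v A)
  part-branching v A with Partition.nonempty (P v) A
  ... | u , u∈A with ∈N⁻ R(Equivalence.from (Partition.covers (P v) u) (A , u∈A))
  ...   | vu = orig v , part u (proj₁ vB) , bwd (E₂ v A) , fwd (E₃ vu u∈A (proj₂ vB)) , λ ()
    where vB = blockAt (Graph.sym R vu)

  branching⇒¬leaf : ∀ {x} → Branching (to x) → ¬ x ∈ leaves T
  branching⇒¬leaf {x} (y , z , xy , xz , y≢z) x∈ = y≢z
    (trans (sym (strictlyInverseˡ y)) (trans (cong to (leaf⁻ T x∈ (adj xy) (adj xz)))
      (strictlyInverseˡ z)))
    where
    adj : ∀ {y} → Adj graph (to x) y → Adj T x (from y)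
    adj = subst (λ w → Adj T w _) (strictlyInverseʳ x) ∘ adj-from

  leaf⇒pend : ∀ {x} → x ∈ leaves T → ∃[ v ] to x ≡ pend v
  leaf⇒pend {x} x∈ with to x in eq
  ... | orig v   = ⊥-elim (branching⇒¬leaf (subst Branching (sym eq) (orig-branching v)) x∈)
  ... | pend v   = v , refl
  ... | part v A = ⊥-elim (branching⇒¬leaf (subst Branching (sym eq) (part-branching v A)) x∈)

  pend-neighbour : ∀ {x v y} → to x ≡ pend v → Adj T x y → to y ≡ orig v
  pend-neighbour {x} {y = y} eq e with to x | to y | adj-to e
  pend-neighbour refl e | pend v | _ | bwd (E₁ _) = refl

  orig-pend-neighbour : ∀ {v w} → Adj graph (orig v) (pend w) → w ≡ v
  orig-pend-neighbour (fwd (E₁ _)) = refl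

  from-pend-leaf : ∀ v → from (pend v) ∈ leaves T
  from-pend-leaf v = leaf⁺ T (adj-from (bwd (E₁ v))) λ e →
    to≡⇒≡from (pend-neighbour (strictlyInverseˡ (pend v)) e)

  from-orig-weakSupport : ∀ v → from (orig v) ∈ weakSupports T
  from-orig-weakSupport v = weakSupport⁺ T (adj-from (fwd (E₁ v))) (from-pend-leaf v)
    λ {z} e z∈ → let w , eq = leaf⇒pend z∈ in
      to≡⇒≡from (trans eq (cong pend (orig-pend-neighbour
        (subst₂ (Adj graph) (strictlyInverseˡ (orig v)) eq (adj-to e)))))

  -- The leaf beside a weak support corresponds to some `pend v`, whose only neighbour is `orig v`.
  weakSupport⇒orig : ∀ {x} → x ∈ weakSupports T → ∃[ v ] to x ≡ orig v
  weakSupport⇒orig x∈ with weakSupport⁻ T x∈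
  ... | l , xl , l∈ , _ with leaf⇒pend l∈
  ...   | v , eq = v , pend-neighbour eq (Graph.sym T xl)

  near-to : ∀ {x y} → Near T x y → Near graph (to x) (to y)
  near-to (inj₁ refl) = inj₁ refl
  near-to (inj₂ e)    = inj₂ (adj-to e)

  near-from : ∀ {v w} → Near graph v w → Near T (from v) (from w)
  near-from (inj₁ refl) = inj₁ refl
  near-from (inj₂ e)    = inj₂ (adj-from e)

  cell-determined : ∀ {x u i} → Near T x u → to u ≡ orig i → cell (to x) ≡ i
  cell-determined xu eq = near-orig⇒cell≡ (subst (Near graph _) eq (near-to xu))

  weakSupports-near-unique : ∀ {x u v} → u ∈ weakSupports T → v ∈ weakSupports T →
                             Near T x u → Near T x v → u ≡ v
  weakSupports-near-unique u∈ v∈ xu xv =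
    let i , eqᵤ = weakSupport⇒orig u∈
        j , eqᵥ = weakSupport⇒orig v∈
        i≡j = trans (sym (cell-determined xu eqᵤ)) (cell-determined xv eqᵥ)
    in trans (to≡⇒≡from eqᵤ) (trans (cong (from ∘ orig) i≡j) (sym (to≡⇒≡from eqᵥ)))

  -- For maximality, each member of a packing `S` is sent to the centre of its cell. Two members
  -- with the same centre lie in one closed neighbourhood, so they coincide and the map is
  -- injective.
  maximum : IsMaximum2Packing T (weakSupports T)
  maximum = near-unique⇒packing T weakSupports-near-unique , λ S packing →
    injective⇒≤∣S∣ (weakSupports T) (centre ∘ enum S) (λ _ → from-orig-weakSupport _)
      λ {i} {j} eq → enum-injective S (packing⇒near-unique T packing (enum-∈ S i) (enum-∈ S j)
        (near-sym T (near-centre (enum S i)))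
        (near-sym T (subst (Near T _) (sym eq) (near-centre (enum S j)))))
    where
    centre : Fin n → Fin n
    centre x = from (orig (cell (to x)))
    near-centre : ∀ x → Near T x (centre x)
    near-centre x = subst (λ w → Near T w (centre x)) (strictlyInverseʳ x)
                      (near-from (near-cell (to x)))

-- Partition of a tree into closed neighbourhoods

record Cells {n : ℕ} (T : Graph (Fin n)) : Set where
  field
    count        : ℕ
    centre       : Fin count → Fin n
    pendant      : Fin count → Fin n
    cell         : Fin n → Fin count
    -- These two fields say that the closed neighbourhoods of the centres cover `T` and are
    -- disjoint.
    near-centre  : ∀ x → Near T x (centre (cell x))
    cell-unique  : ∀ {x i} → Near T x (centre i) → cell x ≡ i
    pendant-adj  : ∀ i → Adj T (centre i) (pendant i)
    pendant-leaf : ∀ {i x} → Adj T (pendant i) x → x ≡ centre i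
    -- No other neighbour of a centre is a leaf, expressed by a second neighbour.
    inner        : ∀ {i x} → Adj T (centre i) x → x ≢ pendant i →
                   ∃[ y ] Adj T x y × y ≢ centre i

-- Domination by a maximum packing of weak supports

module FromMaximumPacking {n} {T : Graph (Fin n)}
  (maximum : IsMaximum2Packing T (weakSupports T)) where

  W : Subset n
  W = weakSupports T

  centre : Fin ∣ W ∣ → Fin n
  centre = enum W

  near-unique : ∀ {x i j} → Near T x (centre i) → Near T x (centre j) → i ≡ j
  near-unique xi xj = enum-injective W
    (packing⇒near-unique T (proj₁ maximum) (enum-∈ W _) (enum-∈ W _) xi xj)

  pendant : Fin ∣ W ∣ → Fin n
  pendant i = proj₁ (weakSupport⁻ T (enum-∈ W i))

  pendant-adj : ∀ i → Adj T (centre i) (pendant i)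
  pendant-adj i = proj₁ (proj₂ (weakSupport⁻ T (enum-∈ W i)))

  pendant∈leaves : ∀ i → pendant i ∈ leaves T
  pendant∈leaves i = proj₁ (proj₂ (proj₂ (weakSupport⁻ T (enum-∈ W i))))

  pendant-unique : ∀ {i x} → Adj T (centre i) x → x ∈ leaves T → x ≡ pendant i
  pendant-unique {i} = proj₂ (proj₂ (proj₂ (weakSupport⁻ T (enum-∈ W i))))

  pendant-leaf : ∀ {i x} → Adj T (pendant i) x → x ≡ centre i
  pendant-leaf {i} e = leaf⁻ T (pendant∈leaves i) e (Graph.sym T (pendant-adj i))

  near-pendant : ∀ {x i} → Near T x (pendant i) → x ≡ pendant i ⊎ x ≡ centre i
  near-pendant (inj₁ eq) = inj₁ eq
  near-pendant (inj₂ e)  = inj₂ (pendant-leaf (Graph.sym T e))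

  -- The closed neighbourhood of a pendant lies inside that of its centre, so pendants inherit
  -- `near-unique` from the centres.
  near-pendant⇒near-centre : ∀ {x i} → Near T x (pendant i) → Near T x (centre i)
  near-pendant⇒near-centre {i = i} p with near-pendant p
  ... | inj₁ refl = inj₂ (Graph.sym T (pendant-adj i))
  ... | inj₂ refl = inj₁ refl

  -- Without a second neighbour, `x` would be a leaf at a weak support and hence its pendant.
  inner : ∀ {i x} → Adj T (centre i) x → x ≢ pendant i → ∃[ y ] Adj T x y × y ≢ centre i
  inner {i} {x} ix x≢ with any? (λ y → Graph.adj? T x y ×-dec ¬? (y ≟ centre i))
  ... | yes found = found
  ... | no  none  = ⊥-elim (x≢ (pendant-unique ix (leaf⁺ T (Graph.sym T ix) only)))
    where
    only : ∀ {z} → Adj T x z → z ≡ centre i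
    only {z} xz with z ≟ centre i
    ... | yes eq = eq
    ... | no  z≢ = ⊥-elim (none (z , xz , z≢))

  -- A vertex `x` outside all the closed neighbourhoods may be at distance 2 from a centre, but it
  -- is at distance at least 3 from every pendant. So `x` can be added to the pendants, though
  -- perhaps not to the centres.
  module Undominated {x : Fin n} (undominated : ∀ i → ¬ Near T x (centre i)) where

    Extended : Pred (Fin n) _
    Extended y = y ≡ x ⊎ ∃[ i ] y ≡ pendant i

    extended? : U.Decidable Extended
    extended? y = (y ≟ x) ⊎-dec any? (λ i → y ≟ pendant i)

    -- Such a `z` would be the pendant or its centre, and either way `x` would be near that centre.
    apart : ∀ {z i} → Near T z x → ¬ Near T z (pendant i)
    apart {i = i} zx zi with near-pendant zi
    ... | inj₂ refl = undominated i (near-sym T zx)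
    ... | inj₁ refl with near-sym T zx
    ...   | inj₁ refl = undominated i (near-pendant⇒near-centre (inj₁ refl))
    ...   | inj₂ e    = undominated i (inj₁ (pendant-leaf (Graph.sym T e)))

    extended-packing : Is2Packing T (comprehension extended?)
    extended-packing = near-unique⇒packing T λ u∈ v∈ →
      unique (∈-comprehension⁻ extended? u∈) (∈-comprehension⁻ extended? v∈)
      where
      unique : ∀ {z u v} → Extended u → Extended v → Near T z u → Near T z v → u ≡ v
      unique (inj₁ refl)       (inj₁ refl)       _  _  = refl
      unique (inj₁ refl)       (inj₂ (i , refl)) zu zv = ⊥-elim (apart zu zv)
      unique (inj₂ (i , refl)) (inj₁ refl)       zu zv = ⊥-elim (apart zv zu)
      unique (inj₂ (i , refl)) (inj₂ (j , refl)) zu zv =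
        cong pendant (near-unique (near-pendant⇒near-centre zu) (near-pendant⇒near-centre zv))

    list : Fin (suc ∣ W ∣) → Fin n
    list zero    = x
    list (suc i) = pendant i

    list-injective : Injective _≡_ _≡_ list
    list-injective {zero}  {zero}  _  = refl
    list-injective {zero}  {suc j} eq = ⊥-elim (apart (inj₁ refl) (inj₁ eq))
    list-injective {suc i} {zero}  eq = ⊥-elim (apart (inj₁ refl) (inj₁ (sym eq)))
    list-injective {suc i} {suc j} eq = cong suc
      (near-unique (near-pendant⇒near-centre (inj₁ refl)) (near-pendant⇒near-centre (inj₁ eq)))

    contradiction : ∀ {A : Set} → A
    contradiction = ⊥-elim (1+n≰n (≤-trans
      (injective⇒≤∣S∣ (comprehension extended?) list
        (λ i → ∈-comprehension⁺ extended? (list-extended i)) list-injective)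
      (proj₂ maximum _ extended-packing)))
      where
      list-extended : ∀ i → Extended (list i)
      list-extended zero    = inj₁ refl
      list-extended (suc i) = inj₂ (i , refl)

  dominated : ∀ x → ∃[ i ] Near T x (centre i)
  dominated x with any? (λ i → near? T x (centre i))
  ... | yes found = found
  ... | no  none  = Undominated.contradiction (λ i xi → none (i , xi))

  cells : Cells T
  cells = record
    { count        = ∣ W ∣
    ; centre       = centre
    ; pendant      = pendant
    ; cell         = proj₁ ∘ dominated
    ; near-centre  = proj₂ ∘ dominated
    -- `dominated` finds some centre by search; the packing property makes it the only one.
    ; cell-unique  = near-unique (proj₂ (dominated _))
    ; pendant-adj  = pendant-adj
    ; pendant-leaf = pendant-leaf
    ; inner        = inner
    }

-- Contracting the cells to a tree

module Contraction {n} {T : Graph (Fin n)} (2<n : 2 < n) (tree : IsTree T) (D : Cells T) where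

  open Cells D

  bridges : EveryEdgeBridge T
  bridges = acyclic⇒bridges (proj₂ tree)

  triangle-free : ∀ {x y z} → Adj T x y → Adj T y z → ¬ Adj T x z
  triangle-free xy yz xz = bridges xz
    ( (xy , (λ { (_ , refl) → Graph.irrefl T refl yz }) , (λ { (refl , _) → Graph.irrefl T refl xz }))
    ◅ (yz , (λ { (refl , _) → Graph.irrefl T refl xy }) , (λ { (refl , _) → Graph.irrefl T refl yz }))
    ◅ ε)

  cell-centre : ∀ i → cell (centre i) ≡ i
  cell-centre i = cell-unique (inj₁ refl)

  cell-neighbour : ∀ {i x} → Adj T (centre i) x → cell x ≡ i
  cell-neighbour e = cell-unique (inj₂ (Graph.sym T e))

  cell-pendant : ∀ i → cell (pendant i) ≡ i
  cell-pendant i = cell-neighbour (pendant-adj i)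

  within-cell : ∀ {a b x y} → cell a ≢ cell b → Adj T x y → cell x ≡ cell y →
                Adj (deleteEdge T a b) x y
  within-cell a≢b xy x≡y =
    xy , (λ { (refl , refl) → a≢b x≡y }) , (λ { (refl , refl) → a≢b (sym x≡y) })

  -- Each cell is a star around its centre, and deleting an edge between different cells leaves
  -- these stars intact.
  toCentre : ∀ {a b} → cell a ≢ cell b → ∀ x →
             Connection (deleteEdge T a b) x (centre (cell x))
  toCentre a≢b x with near-centre x
  ... | inj₁ eq = ≡⇒connection (deleteEdge T _ _) eq
  ... | inj₂ e  = within-cell a≢b e (sym (cell-centre _)) ◅ ε

  fromCentre : ∀ {a b} → cell a ≢ cell b → ∀ x →
               Connection (deleteEdge T a b) (centre (cell x)) x
  fromCentre a≢b x with near-centre x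
  ... | inj₁ eq = ≡⇒connection (deleteEdge T _ _) (sym eq)
  ... | inj₂ e  = within-cell a≢b (Graph.sym T e) (cell-centre _) ◅ ε

  same-cell : ∀ {a b} → cell a ≢ cell b → ∀ {x y} → cell x ≡ cell y →
              Connection (deleteEdge T a b) x y
  same-cell a≢b {x} {y} eq =
    toCentre a≢b x ◅◅ ≡⇒connection (deleteEdge T _ _) (cong centre eq) ◅◅ fromCentre a≢b y

  -- At most one edge joins two given cells: a second one, together with the connections inside both
  -- cells, would bypass the bridge `ab`.
  crossing-unique : ∀ {a b x y} → cell a ≢ cell b → Adj T a b → Adj T x y →
                    cell x ≡ cell a → cell y ≡ cell b → x ≡ a × y ≡ b
  crossing-unique {a} {b} {x} {y} a≢b ab xy xa yb with (x ≟ a) ×-dec (y ≟ b)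
  ... | yes eq = eq
  ... | no neq = ⊥-elim (bridges ab
    (same-cell a≢b (sym xa)
     ◅◅ (xy , neq , λ { (refl , refl) → a≢b (sym xa) })
     ◅ same-cell a≢b yb))

  near⇒adj : ∀ {x y} → Near T x y → x ≢ y → Adj T x y
  near⇒adj (inj₁ eq) x≢y = ⊥-elim (x≢y eq)
  near⇒adj (inj₂ e)  _   = e

  -- A second neighbour of `x` inside the same cell would be adjacent to the centre as well, closing
  -- a triangle.
  neighbour-outside : ∀ {i x} → Adj T (centre i) x → x ≢ pendant i →
                      ∃[ y ] Adj T x y × i ≢ cell y
  neighbour-outside {i} ix x≢ with inner ix x≢
  ... | y , xy , y≢ = y , xy , λ { refl →
    triangle-free ix xy (Graph.sym T (near⇒adj (near-centre y) y≢)) }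

  -- With a single cell, `neighbour-outside` leaves room for nothing but the centre and the pendant,
  -- so `T` would have at most two vertices.
  2≤count : 2 ≤ count
  2≤count with 2 ℕ.≤? count
  ... | yes 2≤c = 2≤c
  ... | no  2≰c = ⊥-elim (<⇒≱ 2<n (injective⇒≤ {f = proj₁ ∘ position} position-injective))
    where
    subsingleton : ∀ {k} → ¬ 2 ≤ k → (i j : Fin k) → i ≡ j
    subsingleton {1}           _   zero zero = refl
    subsingleton {suc (suc k)} 2≰k _    _    = ⊥-elim (2≰k (s≤s (s≤s z≤n)))

    i₀ : Fin count
    i₀ = cell (fromℕ< 2<n)

    vertex : Fin 2 → Fin n
    vertex zero       = centre i₀
    vertex (suc zero) = pendant i₀

    position : ∀ x → ∃[ b ] vertex b ≡ x
    position x with centre i₀ ≟ x | pendant i₀ ≟ x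
    ... | yes eq | _      = zero , eq
    ... | no _   | yes eq = suc zero , eq
    ... | no c≢x | no p≢x with neighbour-outside (near⇒adj near c≢x) (p≢x ∘ sym)
      where
      near : Near T (centre i₀) x
      near = near-sym T (subst (Near T x ∘ centre) (subsingleton 2≰c _ _) (near-centre x))
    ...   | y , _ , i₀≢cell = ⊥-elim (i₀≢cell (subsingleton 2≰c _ _))

    position-injective : Injective _≡_ _≡_ (proj₁ ∘ position)
    position-injective {x} {y} eq =
      trans (sym (proj₂ (position x))) (trans (cong vertex eq) (proj₂ (position y)))

  CellAdj : Fin count → Fin count → Set
  CellAdj i j = i ≢ j × ∃[ x ] ∃[ y ] Adj T x y × cell x ≡ i × cell y ≡ j

  contraction : Graph (Fin count)
  contraction = record
    { Adj    = CellAdj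
    ; sym    = λ (i≢j , x , y , xy , xi , yj) → i≢j ∘ sym , y , x , Graph.sym T xy , yj , xi
    ; irrefl = λ i≡j (i≢j , _) → i≢j i≡j
    ; adj?   = λ i j → ¬? (i ≟ j) ×-dec any? λ x → any? λ y →
                 Graph.adj? T x y ×-dec (cell x ≟ i) ×-dec (cell y ≟ j)
    }

  project : ∀ {x y} → Connection T x y → Connection contraction (cell x) (cell y)
  project ε = ε
  project (_◅_ {x} {y} e c) with cell x ≟ cell y
  -- Edges inside a cell collapse.
  ... | yes eq = ≡⇒connection contraction eq ◅◅ project c
  ... | no neq = (neq , x , y , e , refl , refl) ◅ project c

  contraction-connected : Connected contraction
  contraction-connected i j = connection⇒walk (subst₂ (Connection contraction)
    (cell-centre i) (cell-centre j)
    (project (walk⇒connection (proj₂ (proj₁ tree (centre i) (centre j))))))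

  -- A detour around the contracted edge lifts to one around `ab`: each step becomes a crossing edge
  -- between the two centres' cells, and this edge is not `ab` because it joins a different pair of
  -- cells.
  contraction-bridges : EveryEdgeBridge contraction
  contraction-bridges (a≢b , a , b , ab , refl , refl) c =
    bridges ab (toCentre a≢b a ◅◅ kleisliStar centre lift c ◅◅ fromCentre a≢b b)
    where
    lift : ∀ {i j} → Adj (deleteEdge contraction (cell a) (cell b)) i j →
           Connection (deleteEdge T a b) (centre i) (centre j)
    lift ((_ , x , y , xy , refl , refl) , ij≢ab , ij≢ba) =
      fromCentre a≢b x
      ◅◅ (xy , (λ { (refl , refl) → ij≢ab (refl , refl) })
             , (λ { (refl , refl) → ij≢ba (refl , refl) }))
      ◅ toCentre a≢b y

  contraction-tree : IsTree contraction
  contraction-tree = contraction-connected , bridges⇒acyclic contraction-bridges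

  -- The partitions given by inner vertices

  Inner : Fin count → Pred (Fin n) _
  Inner i x = Adj T (centre i) x × x ≢ pendant i

  inner? : ∀ i → U.Decidable (Inner i)
  inner? i x = Graph.adj? T (centre i) x ×-dec ¬? (x ≟ pendant i)

  innerVertices : Fin count → Subset n
  innerVertices i = comprehension (inner? i)

  -- The end of a crossing edge is neither a centre nor a pendant, since all neighbours of those lie
  -- in their own cell.
  crossing⇒inner : ∀ {x y} → Adj T x y → cell x ≢ cell y → Inner (cell x) x
  crossing⇒inner {x} {y} xy x≢y =
    Graph.sym T (near⇒adj (near-centre x) λ x≡c →
      x≢y (sym (cell-unique (inj₂ (subst (Adj T y) x≡c (Graph.sym T xy)))))) ,
    λ x≡p → x≢y (sym (trans (cong cell (pendant-leaf (subst (λ z → Adj T z y) x≡p xy)))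
                        (cell-centre _)))

  Reaches : Fin n → Pred (Fin count) _
  Reaches x j = cell x ≢ j × ∃[ y ] Adj T x y × cell y ≡ j

  reaches? : ∀ x → U.Decidable (Reaches x)
  reaches? x j = ¬? (cell x ≟ j) ×-dec any? λ y → Graph.adj? T x y ×-dec (cell y ≟ j)

  innerAt : ∀ i → Fin ∣ innerVertices i ∣ → Fin n
  innerAt i = enum (innerVertices i)

  innerAt-inner : ∀ i A → Inner i (innerAt i A)
  innerAt-inner i A = ∈-comprehension⁻ (inner? i) (enum-∈ (innerVertices i) A)

  cell-innerAt : ∀ i A → cell (innerAt i A) ≡ i
  cell-innerAt i A = cell-neighbour (proj₁ (innerAt-inner i A))

  innerAt-surjective : ∀ {i x} → Inner i x → ∃[ A ] innerAt i A ≡ x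
  innerAt-surjective {i} p = enum-surjective (innerVertices i) (∈-comprehension⁺ (inner? i) p)

  -- Both would be ends of the single edge between the two cells.
  reaches-unique : ∀ {x x′ j} → cell x ≡ cell x′ → Reaches x j → Reaches x′ j → x ≡ x′
  reaches-unique xx′ (_ , y , xy , yj) (x′≢ , y′ , xy′ , refl) =
    proj₁ (crossing-unique x′≢ xy′ xy xx′ yj)

  -- Blocks at `i` are indexed by the inner vertices of the cell. They are nonempty by
  -- `neighbour-outside`, disjoint by `reaches-unique`, and cover the neighbours by
  -- `crossing⇒inner`.
  partition : ∀ i → Partition (N contraction i)
  partition i = record
    { size     = ∣ innerVertices i ∣
    ; block    = blockOf
    ; nonempty = λ A →
        let ix , x≢p   = innerAt-inner i A
            y , xy , i≢ = neighbour-outside ix x≢p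
        in cell y , ∈-comprehension⁺ (reaches? (innerAt i A))
             ((λ eq → i≢ (trans (sym (cell-innerAt i A)) eq)) , y , xy , refl)
    ; disjoint = λ {A} {B} A≢B (j , j∈) →
        let j∈A , j∈B = x∈p∩q⁻ (blockOf A) (blockOf B) j∈
        in A≢B (enum-injective (innerVertices i)
             (reaches-unique (trans (cell-innerAt i A) (sym (cell-innerAt i B)))
               (∈-comprehension⁻ (reaches? (innerAt i A)) j∈A)
               (∈-comprehension⁻ (reaches? (innerAt i B)) j∈B)))
    ; covers   = λ j → mk⇔ (covered j ∘ ∈N⁻ contraction)
        λ (A , j∈A) → ∈N⁺ contraction (adjacent A (∈-comprehension⁻ (reaches? (innerAt i A)) j∈A))
    }
    where
    blockOf : Fin ∣ innerVertices i ∣ → Subset count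
    blockOf A = comprehension (reaches? (innerAt i A))

    covered : ∀ j → CellAdj i j → ∃[ A ] j ∈ blockOf A
    covered j (i≢j , x , y , xy , refl , refl) with innerAt-surjective (crossing⇒inner xy i≢j)
    ... | A , eq = A , ∈-comprehension⁺ (reaches? (innerAt i A))
      (subst (λ z → Reaches z j) (sym eq) (i≢j , y , xy , refl))

    adjacent : ∀ {j} A → Reaches (innerAt i A) j → CellAdj i j
    adjacent A (x≢ , y , xy , yj) =
      (λ i≡j → x≢ (trans (cell-innerAt i A) i≡j)) ,
      innerAt i A , y , xy , cell-innerAt i A , yj

  -- The isomorphism with the subdivision

  open Subdivision contraction partition
  open SubdivisionCells contraction partition renaming (cell to cellOf) using ()

  embed : Vertex → Fin n
  embed (orig i)   = centre i
  embed (pend i)   = pendant i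
  embed (part i A) = innerAt i A

  cell-embed : ∀ v → cell (embed v) ≡ cellOf v
  cell-embed (orig i)   = cell-centre i
  cell-embed (pend i)   = cell-pendant i
  cell-embed (part i A) = cell-innerAt i A

  -- Equal images lie in the same cell, so only vertices over one index `i` need comparing.
  embed-injective : Injective _≡_ _≡_ embed
  embed-injective {v} {w} eq with trans (sym (cell-embed v)) (trans (cong cell eq) (cell-embed w))
  embed-injective {orig i}   {orig .i}   eq | refl = refl
  embed-injective {orig i}   {pend .i}   eq | refl = ⊥-elim (Graph.irrefl T eq (pendant-adj i))
  embed-injective {orig i}   {part .i B} eq | refl =
    ⊥-elim (Graph.irrefl T eq (proj₁ (innerAt-inner i B)))
  embed-injective {pend i}   {orig .i}   eq | refl = ⊥-elim (Graph.irrefl T (sym eq) (pendant-adj i))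
  embed-injective {pend i}   {pend .i}   eq | refl = refl
  embed-injective {pend i}   {part .i B} eq | refl = ⊥-elim (proj₂ (innerAt-inner i B) (sym eq))
  embed-injective {part i A} {orig .i}   eq | refl =
    ⊥-elim (Graph.irrefl T (sym eq) (proj₁ (innerAt-inner i A)))
  embed-injective {part i A} {pend .i}   eq | refl = ⊥-elim (proj₂ (innerAt-inner i A) eq)
  embed-injective {part i A} {part .i B} eq | refl =
    cong (part i) (enum-injective (innerVertices i) eq)

  embed-surjective : ∀ x → ∃[ v ] embed v ≡ x
  embed-surjective x with centre (cell x) ≟ x | pendant (cell x) ≟ x
  ... | yes eq | _      = orig (cell x) , eq
  ... | no _   | yes eq = pend (cell x) , eq
  ... | no c≢x | no p≢x
    with innerAt-surjective (near⇒adj (near-sym T (near-centre x)) c≢x , p≢x ∘ sym)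
  ...   | A , eq = part (cell x) A , eq

  edge⇒adj : ∀ {v w} → Edge v w → Adj T (embed v) (embed w)
  edge⇒adj (E₁ i)   = pendant-adj i
  edge⇒adj (E₂ i A) = proj₁ (innerAt-inner i A)
  edge⇒adj (E₃ {i} {j} {A} {B} _ j∈A i∈B)
    with ∈-comprehension⁻ (reaches? (innerAt i A)) j∈A
       | ∈-comprehension⁻ (reaches? (innerAt j B)) i∈B
  ... | i≢j , y , xy , yj | _ , x′ , yx′ , x′i =
    subst (Adj T (innerAt i A)) (sym y≡) xy
    where
    -- The two block memberships yield one crossing edge leaving `innerAt i A` and one leaving
    -- `innerAt j B`; by uniqueness they are the same edge.
    y≡ : innerAt j B ≡ y
    y≡ = proj₂ (crossing-unique (λ eq → i≢j (trans eq yj)) xy (Graph.sym T yx′)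
           (trans x′i (sym (cell-innerAt i A))) (trans (cell-innerAt j B) (sym yj)))

  adj-centre : ∀ {i w} → Adj T (centre i) (embed w) → Adj graph (orig i) w
  adj-centre {i} {w} e with trans (sym (cell-embed w)) (cell-neighbour e)
  adj-centre {w = orig i}   e | refl = ⊥-elim (Graph.irrefl T refl e)
  adj-centre {w = pend i}   e | refl = fwd (E₁ i)
  adj-centre {w = part i A} e | refl = fwd (E₂ i A)

  adj-pendant : ∀ {i w} → Adj T (pendant i) (embed w) → Adj graph (pend i) w
  adj-pendant {i} {w} e with embed-injective {w} {orig i} (pendant-leaf e)
  ... | refl = bwd (E₁ i)

  adj-inner : ∀ {i A j B} → Adj T (innerAt i A) (innerAt j B) → Adj graph (part i A) (part j B)
  adj-inner {i} {A} {j} {B} e with i ≟ j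
  -- Two adjacent inner vertices of one cell would form a triangle with the centre.
  ... | yes refl = ⊥-elim
    (triangle-free (proj₁ (innerAt-inner i A)) e (proj₁ (innerAt-inner i B)))
  ... | no i≢j = fwd (E₃ (i≢j , _ , _ , e , cell-innerAt i A , cell-innerAt j B)
      (∈-comprehension⁺ (reaches? (innerAt i A))
        ((λ eq → i≢j (trans (sym (cell-innerAt i A)) eq)) , _ , e , cell-innerAt j B))
      (∈-comprehension⁺ (reaches? (innerAt j B))
        ((λ eq → i≢j (trans (sym eq) (cell-innerAt j B))) , _ , Graph.sym T e , cell-innerAt i A)))

  adj-embed⁺ : ∀ {v w} → Adj graph v w → Adj T (embed v) (embed w)
  adj-embed⁺ (fwd e) = edge⇒adj e
  adj-embed⁺ (bwd e) = Graph.sym T (edge⇒adj e)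

  adj-embed⁻ : ∀ v w → Adj T (embed v) (embed w) → Adj graph v w
  adj-embed⁻ (orig i)   w          e = adj-centre e
  adj-embed⁻ (pend i)   w          e = adj-pendant e
  adj-embed⁻ (part i A) (orig j)   e = Graph.sym graph (adj-centre (Graph.sym T e))
  adj-embed⁻ (part i A) (pend j)   e = Graph.sym graph (adj-pendant (Graph.sym T e))
  adj-embed⁻ (part i A) (part j B) e = adj-inner e

  isomorphic : T ≅ graph
  isomorphic = record
    { bijection = mk↔ₛ′ to embed (λ v → embed-injective (embed-to (embed v))) embed-to
    ; preserves = λ x y → mk⇔
        (λ e → adj-embed⁻ (to x) (to y)
                 (subst₂ (Adj T) (sym (embed-to x)) (sym (embed-to y)) e))
        (λ e → subst₂ (Adj T) (embed-to x) (embed-to y) (adj-embed⁺ e))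
    }
    where
    to : Fin n → Vertex
    to x = proj₁ (embed-surjective x)
    embed-to : ∀ x → embed (to x) ≡ x
    embed-to x = proj₂ (embed-surjective x)

  ∈𝒪′ : 𝒪′ T
  ∈𝒪′ = tree , count , 2≤count , contraction , contraction-tree , partition , isomorphic

mainTheorem5 : ∀ (n : ℕ) → 6 ≤ n → (T : Graph (Fin n)) → IsTree T →
    𝒪′ T ⇔ IsMaximum2Packing T (weakSupports T)
mainTheorem5 n 6≤n T tree = mk⇔
  (λ (_ , _ , 2≤m , _ , (connected , _) , P , iso) → FromSubdivision.maximum 2≤m connected P iso)
  (λ maximum → Contraction.∈𝒪′ (≤-trans (s≤s (s≤s (s≤s z≤n))) 6≤n) tree
                 (FromMaximumPacking.cells maximum))
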